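{- For every integer $n\geq 1$, the following twelve identities hold in $\mathbb{Z}[x]$: (1) $xF_{n}(x)+(4x^3-x^2-3x)F_{n-1}(x)=T_{2n-1}(x)-\sum_{k=1}^{n-2}\bigl((4x^2-x-2)T_{2(n-k)-1}(x)-2T_{2(n-k)-3}(x)\bigr)F_{k}(x)$; (2) $2xF_{n}(x)+(8x^3-2x^2-4x)F_{n-1}(x)= U_{2n-1}(x)-\sum_{k=1}^{n-2}\bigl((4x^2-x-2)U_{2(n-k)-1}(x)-2U_{2(n-k)-3}(x)\bigr)F_{k}(x)$; (3) $F_{n}(x)+(2x^2-x-1)F_{n-1}(x)=T_{2n-2}(x)-\sum_{k=1}^{n-2}\bigl((4x^2-x-2)T_{2(n-k-1)}(x)-2T_{2(n-k-2)}(x)\bigr)F_{k}(x)$; (4) $F_{n}(x)+(4x^2-x-1)F_{n-1}(x)=U_{2n-2}(x)-\sum_{k=1}^{n-2}\bigl((4x^2-x-2)U_{2(n-k-1)}(x)-2U_{2(n-k-2)}(x)\bigr)F_{k}(x)$; (5) $F_{2n+1}(x)-(2x^2-1)F_{2n-1}(x)=T_{2n}(x)-T_{2n-2}(x)-(3x^2-4)\sum_{k=0}^{n-1}T_{2(n-k-1)}(x)F_{2k+1}(x)$; (6) $F_{2n+1}(x)+F_{2n-1}(x)=U_{2n}(x)-U_{2n-2}(x)-(3x^2-4)\sum_{k=0}^{n-1}U_{2(n-k-1)}(x)F_{2k+1}(x)$; (7) $x^2F_{2n-1}(x)=xT_{2n-1}(x)-(3x^2-4)\sum_{k=1}^{n-1}T_{2(n-k)-1}(x)F_{2k}(x)$;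 (8) $2xF_{2n}(x)= xU_{2n-1}(x)-(3x^2-4)\sum_{k=1}^{n-1}U_{2(n-k)-1}(x)F_{2k}(x)$; (9) $F_{2n+1}(x)-xF_{2n-1}(x) = T_n(x)-T_{n-1}(x)+(x^2-2x+2)\sum_{k=0}^{n-1}T_{n-1-k}(x)F_{2k+1}(x)$; (10) $F_{2n+1}(x) = U_n(x)-U_{n-1}(x)+(x^2-2x+2)\sum_{k=0}^{n-1}U_{n-1-k}(x)F_{2k+1}(x)$; (11) $F_{2n}(x)-xF_{2n-2}(x) =xT_{n-1}(x)+(x^2-2x+2)\sum_{k=1}^{n-1}T_{n-1-k}(x)F_{2k}(x)$; (12) $F_{2n}(x) = xU_{n-1}(x)+(x^2-2x+2)\sum_{k=1}^{n-1}U_{n-1-k}(x)F_{2k}(x)$.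
   Context: The Chebyshev polynomials of the first kind $T_n(x)$ and of the second kind $U_n(x)$ are defined by $T_0(x)=1$, $T_1(x)=x$, $T_{n+1}(x)=2xT_n(x)-T_{n-1}(x)$, and $U_0(x)=1$, $U_1(x)=2x$, $U_{n+1}(x)=2xU_n(x)-U_{n-1}(x)$ for $n\ge 1$. The (Catalan) Fibonacci polynomials $F_n(x)$ are defined by $F_0(x)=0$, $F_1(x)=1$, $F_n(x)=xF_{n-1}(x)+F_{n-2}(x)$ for $n\geq 2$. A sum whose upper limit is smaller than its lower limit is $0$. -}

module Defs where

open import Algebra.Bundles.Raw using (RawRing)
import Algebra.Definitions.RawSemiring as RawSemiringDefs
open import Data.Fin.Base using (toℕ)
open import Data.Integer.Base as ℤ using (ℤ)
open import Data.List.Base using (List; []; _∷_; map)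
open import Data.Nat.Base as ℕ using (ℕ; zero; suc)
open import Level using (0ℓ)
open import Relation.Binary.PropositionalEquality using (_≡_)

infix  4 _≈_
infixl 6 _+_ _-_
infixl 7 _*_
infix  8 -_

-- a₀ ∷ a₁ ∷ … ∷ aₘ ∷ [] stands for a₀ + a₁x + … + aₘxᵐ.  Trailing zeros are
-- allowed, so the equality of ℤ[x] is _≈_ below and not _≡_.
ℤ[x] : Set
ℤ[x] = List ℤ

coeff : ℤ[x] → ℕ → ℤ
coeff []      _       = ℤ.0ℤ
coeff (a ∷ p) zero    = a
coeff (a ∷ p) (suc i) = coeff p i

-- A record rather than a function type, so that both sides can be inferred.
record _≈_ (p q : ℤ[x]) : Set where
  constructor mk≈
  field
    coeff-≡ : ∀ i → coeff p i ≡ coeff q i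

open _≈_ public

C : ℤ → ℤ[x]
C a = a ∷ []

X : ℤ[x]
X = ℤ.0ℤ ∷ ℤ.1ℤ ∷ []

_+_ : ℤ[x] → ℤ[x] → ℤ[x]
[]      + q       = q
(a ∷ p) + []      = a ∷ p
(a ∷ p) + (b ∷ q) = a ℤ.+ b ∷ p + q

-_ : ℤ[x] → ℤ[x]
- p = map ℤ.-_ p

_-_ : ℤ[x] → ℤ[x] → ℤ[x]
p - q = p + (- q)

-- (a + x p) q = a q + x (p q)
_*_ : ℤ[x] → ℤ[x] → ℤ[x]
[]      * q = []
(a ∷ p) * q = map (a ℤ.*_) q + (ℤ.0ℤ ∷ p * q)

ℤ[x]-rawRing : RawRing 0ℓ 0ℓ
ℤ[x]-rawRing = record
  { Carrier = ℤ[x]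
  ; _≈_     = _≈_
  ; _+_     = _+_
  ; _*_     = _*_
  ; -_      = -_
  ; 0#      = []
  ; 1#      = C ℤ.1ℤ
  }

open RawSemiringDefs (RawRing.rawSemiring ℤ[x]-rawRing) public using (_^_; sum)

-- The sum of f k over a ≤ k ≤ b.  It has suc b ∸ a terms, hence none if b < a.
∑-from-to : ℕ → ℕ → (ℕ → ℤ[x]) → ℤ[x]
∑-from-to a b f = sum {n = suc b ℕ.∸ a} (λ i → f (a ℕ.+ toℕ i))

infix 8 ∑-from-to
syntax ∑-from-to a b (λ k → t) = ∑[ k from a to b ] t

-- Chebyshev polynomials of the first kind.
T : ℕ → ℤ[x]
T zero          = C (ℤ.+ 1)
T (suc zero)    = X
T (suc (suc n)) = C (ℤ.+ 2) * X * T (suc n) - T n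

-- Chebyshev polynomials of the second kind.
U : ℕ → ℤ[x]
U zero          = C (ℤ.+ 1)
U (suc zero)    = C (ℤ.+ 2) * X
U (suc (suc n)) = C (ℤ.+ 2) * X * U (suc n) - U n

-- (Catalan) Fibonacci polynomials.
F : ℕ → ℤ[x]
F zero          = C (ℤ.+ 0)
F (suc zero)    = C (ℤ.+ 1)
F (suc (suc n)) = X * F (suc n) + F n

{-# OPTIONS --safe #-}
module Submission where

-- Let Q satisfy Q_{k+2} = c Q_{k+1} + d Q_k and let P be any sequence.  With
-- W m k = P_{m+1} Q_{k+1} + d P_m Q_k,
--   (P_{m+2} - c P_{m+1} - d P_m) Q_{k+1} = W (m+1) k - W m (k+1),
-- so the convolution of the left factor with Q telescopes along m + k constant.
-- All twelve identities are instances: P is T, U or one of their bisections, Q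
-- is F or one of its bisections, and when P satisfies a recurrence as well, the
-- left factor reduces to a combination of P_{m+1} and P_m whose coefficients are
-- the differences of those of the two recurrences.

open import Algebra.Bundles using (AbelianGroup; CommutativeRing)
open import Algebra.Definitions using
  (Associative; Commutative; Congruent₂; _DistributesOverˡ_; _DistributesOverʳ_)
import Algebra.Properties.CommutativeSemigroup as CommutativeSemigroupProperties
import Algebra.Properties.Semiring.Sum as SemiringSum
import Algebra.Solver.Ring as RingSolver
open import Algebra.Solver.Ring.AlmostCommutativeRing using
  (fromCommutativeRing; _-Raw-AlmostCommutative⟶_)
open import Data.Fin.Base using (toℕ)
open import Data.Integer.Base as ℤ using (ℤ; +_)
import Data.Integer.Properties as ℤ
open import Data.List.Base using ([]; _∷_; map)
import Data.Maybe.Base as Maybe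
open import Data.Nat.Base as ℕ using (ℕ; zero; suc; _∸_)
import Data.Nat.Properties as ℕ
open import Data.Product.Base using (_×_; _,_)
open import Function.Base using (_∘_)
open import Level using (0ℓ)
open import Relation.Binary.Bundles using (Setoid)
open import Relation.Binary.Consequences using (dec⇒weaklyDec)
open import Relation.Binary.PropositionalEquality as ≡ using (_≡_; cong; cong₂)
import Relation.Binary.Reasoning.Setoid as ≈-Reasoning
open import Defs

-- ℤ[x] as a commutative ring

≈-refl : ∀ {p} → p ≈ p
≈-refl = mk≈ λ _ → ≡.refl

≈-sym : ∀ {p q} → p ≈ q → q ≈ p
≈-sym p≈q = mk≈ λ i → ≡.sym (coeff-≡ p≈q i)

≈-trans : ∀ {p q r} → p ≈ q → q ≈ r → p ≈ r
≈-trans p≈q q≈r = mk≈ λ i → ≡.trans (coeff-≡ p≈q i) (coeff-≡ q≈r i)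

≈-reflexive : ∀ {p q} → p ≡ q → p ≈ q
≈-reflexive ≡.refl = ≈-refl

≈-setoid : Setoid 0ℓ 0ℓ
≈-setoid = record
  { Carrier       = ℤ[x]
  ; _≈_           = _≈_
  ; isEquivalence = record { refl = ≈-refl ; sym = ≈-sym ; trans = ≈-trans }
  }

infixr 5 _∷-cong_

_∷-cong_ : ∀ {a b p q} → a ≡ b → p ≈ q → a ∷ p ≈ b ∷ q
a≡b ∷-cong p≈q = mk≈ λ where
  zero    → a≡b
  (suc i) → coeff-≡ p≈q i

coeff-+ : ∀ p q i → coeff (p + q) i ≡ coeff p i ℤ.+ coeff q i
coeff-+ []      q       i       = ≡.sym (ℤ.+-identityˡ (coeff q i))
coeff-+ (a ∷ p) []      i       = ≡.sym (ℤ.+-identityʳ (coeff (a ∷ p) i))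
coeff-+ (a ∷ p) (b ∷ q) zero    = ≡.refl
coeff-+ (a ∷ p) (b ∷ q) (suc i) = coeff-+ p q i

coeff-- : ∀ p i → coeff (- p) i ≡ ℤ.- coeff p i
coeff-- []      i       = ≡.refl
coeff-- (a ∷ p) zero    = ≡.refl
coeff-- (a ∷ p) (suc i) = coeff-- p i

-- Equal polynomials can be lists of different lengths, so coefficients are compared instead of
-- recursing on the lists.
+-cong : Congruent₂ _≈_ _+_
+-cong {p} {p′} {q} {q′} p≈p′ q≈q′ = mk≈ λ i → begin
  coeff (p + q) i              ≡⟨ coeff-+ p q i ⟩
  coeff p i ℤ.+ coeff q i      ≡⟨ cong₂ ℤ._+_ (coeff-≡ p≈p′ i) (coeff-≡ q≈q′ i) ⟩
  coeff p′ i ℤ.+ coeff q′ i    ≡⟨ coeff-+ p′ q′ i ⟨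
  coeff (p′ + q′) i            ∎
  where open ≡.≡-Reasoning

+-assoc : Associative _≈_ _+_
+-assoc []      q       r       = ≈-refl
+-assoc (a ∷ p) []      r       = ≈-refl
+-assoc (a ∷ p) (b ∷ q) []      = ≈-refl
+-assoc (a ∷ p) (b ∷ q) (c ∷ r) = ℤ.+-assoc a b c ∷-cong +-assoc p q r

+-comm : Commutative _≈_ _+_
+-comm []      []      = ≈-refl
+-comm []      (b ∷ q) = ≈-refl
+-comm (a ∷ p) []      = ≈-refl
+-comm (a ∷ p) (b ∷ q) = ℤ.+-comm a b ∷-cong +-comm p q

+-identityʳ : ∀ p → p + [] ≈ p
+-identityʳ []      = ≈-refl
+-identityʳ (a ∷ p) = ≈-refl

-- The source of all identifications up to trailing zeros: inductions that produce a list of zeros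
-- collapse it to `[]` from the end.
0∷[]≈[] : ℤ.0ℤ ∷ [] ≈ []
0∷[]≈[] = mk≈ λ where
  zero    → ≡.refl
  (suc _) → ≡.refl

0∷-zero : ∀ {p} → p ≈ [] → ℤ.0ℤ ∷ p ≈ []
0∷-zero p≈[] = ≈-trans (≡.refl ∷-cong p≈[]) 0∷[]≈[]

-‿inverseʳ : ∀ p → p - p ≈ []
-‿inverseʳ []      = ≈-refl
-‿inverseʳ (a ∷ p) = ≈-trans (ℤ.+-inverseʳ a ∷-cong -‿inverseʳ p) 0∷[]≈[]

-‿cong : ∀ {p q} → p ≈ q → - p ≈ - q
-‿cong {p} {q} p≈q = mk≈ λ i → begin
  coeff (- p) i    ≡⟨ coeff-- p i ⟩
  ℤ.- coeff p i    ≡⟨ cong ℤ.-_ (coeff-≡ p≈q i) ⟩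
  ℤ.- coeff q i    ≡⟨ coeff-- q i ⟨
  coeff (- q) i    ∎
  where open ≡.≡-Reasoning

+-abelianGroup : AbelianGroup 0ℓ 0ℓ
+-abelianGroup = record
  { Carrier        = ℤ[x]
  ; _≈_            = _≈_
  ; _∙_            = _+_
  ; ε              = []
  ; _⁻¹            = -_
  ; isAbelianGroup = record
    { isGroup = record
      { isMonoid = record
        { isSemigroup = record
          { isMagma = record { isEquivalence = Setoid.isEquivalence ≈-setoid ; ∙-cong = +-cong }
          ; assoc   = +-assoc
          }
        ; identity = (λ _ → ≈-refl) , +-identityʳ
        }
      ; inverse = (λ p → ≈-trans (+-comm (- p) p) (-‿inverseʳ p)) , -‿inverseʳ
      ; ⁻¹-cong = -‿cong
      }
    ; comm = +-comm
    }
  }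

private module + where
  open AbelianGroup +-abelianGroup public using (commutativeSemigroup; ∙-congˡ; ∙-congʳ)
  open CommutativeSemigroupProperties commutativeSemigroup public using (interchange; x∙yz≈y∙xz)

-- Scalar multiples and the product

infixr 7 _·_

-- The first summand in the recursive clause of `_*_`; with its own laws, the ring axioms for `_*_`
-- become inductions on the left factor.
_·_ : ℤ → ℤ[x] → ℤ[x]
a · p = map (a ℤ.*_) p

coeff-· : ∀ a p i → coeff (a · p) i ≡ a ℤ.* coeff p i
coeff-· a []      i       = ≡.sym (ℤ.*-zeroʳ a)
coeff-· a (b ∷ p) zero    = ≡.refl
coeff-· a (b ∷ p) (suc i) = coeff-· a p i

·-congˡ : ∀ a {p q} → p ≈ q → a · p ≈ a · q
·-congˡ a {p} {q} p≈q = mk≈ λ i → begin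
  coeff (a · p) i     ≡⟨ coeff-· a p i ⟩
  a ℤ.* coeff p i     ≡⟨ cong (a ℤ.*_) (coeff-≡ p≈q i) ⟩
  a ℤ.* coeff q i     ≡⟨ coeff-· a q i ⟨
  coeff (a · q) i     ∎
  where open ≡.≡-Reasoning

·-identity : ∀ p → ℤ.1ℤ · p ≈ p
·-identity []      = ≈-refl
·-identity (a ∷ p) = ℤ.*-identityˡ a ∷-cong ·-identity p

·-distribˡ-+ : ∀ a p q → a · (p + q) ≈ a · p + a · q
·-distribˡ-+ a []      q       = ≈-refl
·-distribˡ-+ a (b ∷ p) []      = ≈-refl
·-distribˡ-+ a (b ∷ p) (c ∷ q) = ℤ.*-distribˡ-+ a b c ∷-cong ·-distribˡ-+ a p q

·-distribʳ-+ : ∀ a b p → (a ℤ.+ b) · p ≈ a · p + b · p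
·-distribʳ-+ a b []      = ≈-refl
·-distribʳ-+ a b (c ∷ p) = ℤ.*-distribʳ-+ c a b ∷-cong ·-distribʳ-+ a b p

·-assoc : ∀ a b p → (a ℤ.* b) · p ≈ a · b · p
·-assoc a b []      = ≈-refl
·-assoc a b (c ∷ p) = ℤ.*-assoc a b c ∷-cong ·-assoc a b p

·-zero : ∀ p → ℤ.0ℤ · p ≈ []
·-zero []      = ≈-refl
·-zero (a ∷ p) = ≈-trans (ℤ.*-zeroˡ a ∷-cong ·-zero p) 0∷[]≈[]

*-congˡ : ∀ p {q r} → q ≈ r → p * q ≈ p * r
*-congˡ []      q≈r = ≈-refl
*-congˡ (a ∷ p) q≈r = +-cong (·-congˡ a q≈r) (≡.refl ∷-cong *-congˡ p q≈r)

*-zeroʳ : ∀ p → p * [] ≈ []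
*-zeroʳ []      = ≈-refl
*-zeroʳ (a ∷ p) = 0∷-zero (*-zeroʳ p)

-- Mirror image of the recursive clause of `_*_`, expanding the right factor instead. It is the
-- inductive step of commutativity.
*-∷ : ∀ p b q → p * (b ∷ q) ≈ b · p + (ℤ.0ℤ ∷ p * q)
*-∷ []      b q = ≈-sym 0∷[]≈[]
*-∷ (a ∷ p) b q = cong (ℤ._+ ℤ.0ℤ) (ℤ.*-comm a b) ∷-cong
  ≈-trans (+.∙-congˡ {a · q} (*-∷ p b q)) (+.x∙yz≈y∙xz (a · q) (b · p) (ℤ.0ℤ ∷ p * q))

*-comm : Commutative _≈_ _*_
*-comm []      q = ≈-sym (*-zeroʳ q)
*-comm (a ∷ p) q = ≈-trans
  (+.∙-congˡ {a · q} (≡.refl ∷-cong *-comm p q)) (≈-sym (*-∷ q a p))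

-- `*-congˡ` recurses on a fixed left factor. Commutativity carries it over to the other factor,
-- where recursion would have to match lists of different lengths.
*-cong : Congruent₂ _≈_ _*_
*-cong {p} {p′} {q} {q′} p≈p′ q≈q′ = begin
  p * q      ≈⟨ *-congˡ p q≈q′ ⟩
  p * q′     ≈⟨ *-comm p q′ ⟩
  q′ * p     ≈⟨ *-congˡ q′ p≈p′ ⟩
  q′ * p′    ≈⟨ *-comm q′ p′ ⟩
  p′ * q′    ∎
  where open ≈-Reasoning ≈-setoid

*-distribˡ-+ : _DistributesOverˡ_ _≈_ _*_ _+_
*-distribˡ-+ []      q r = ≈-refl
*-distribˡ-+ (a ∷ p) q r = ≈-trans
  (+-cong (·-distribˡ-+ a q r) (≡.refl ∷-cong *-distribˡ-+ p q r))
  (+.interchange (a · q) (a · r) (ℤ.0ℤ ∷ p * q) (ℤ.0ℤ ∷ p * r))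

*-distribʳ-+ : _DistributesOverʳ_ _≈_ _*_ _+_
*-distribʳ-+ r p q = begin
  (p + q) * r      ≈⟨ *-comm (p + q) r ⟩
  r * (p + q)      ≈⟨ *-distribˡ-+ r p q ⟩
  r * p + r * q    ≈⟨ +-cong (*-comm r p) (*-comm r q) ⟩
  p * r + q * r    ∎
  where open ≈-Reasoning ≈-setoid

·-*-assoc : ∀ a p q → (a · p) * q ≈ a · (p * q)
·-*-assoc a []      q = ≈-refl
·-*-assoc a (b ∷ p) q = begin
  (a ℤ.* b) · q + (ℤ.0ℤ ∷ (a · p) * q)
    ≈⟨ +-cong (·-assoc a b q) (≡.sym (ℤ.*-zeroʳ a) ∷-cong ·-*-assoc a p q) ⟩
  a · b · q + a · (ℤ.0ℤ ∷ p * q)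
    ≈⟨ ·-distribˡ-+ a (b · q) (ℤ.0ℤ ∷ p * q) ⟨
  a · (b · q + (ℤ.0ℤ ∷ p * q))
    ∎
  where open ≈-Reasoning ≈-setoid

0∷-*-assoc : ∀ p q → (ℤ.0ℤ ∷ p) * q ≈ ℤ.0ℤ ∷ p * q
0∷-*-assoc p q = +.∙-congʳ (·-zero q)

*-assoc : Associative _≈_ _*_
*-assoc []      q r = ≈-refl
*-assoc (a ∷ p) q r = begin
  (a · q + (ℤ.0ℤ ∷ p * q)) * r            ≈⟨ *-distribʳ-+ r (a · q) (ℤ.0ℤ ∷ p * q) ⟩
  (a · q) * r + (ℤ.0ℤ ∷ p * q) * r        ≈⟨ +-cong (·-*-assoc a q r) (0∷-*-assoc (p * q) r) ⟩
  a · (q * r) + (ℤ.0ℤ ∷ (p * q) * r)      ≈⟨ +.∙-congˡ {a · (q * r)} (≡.refl ∷-cong *-assoc p q r) ⟩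
  a · (q * r) + (ℤ.0ℤ ∷ p * (q * r))      ∎
  where open ≈-Reasoning ≈-setoid

*-identityˡ : ∀ p → C ℤ.1ℤ * p ≈ p
*-identityˡ p = begin
  ℤ.1ℤ · p + (ℤ.0ℤ ∷ [])    ≈⟨ +-cong (·-identity p) 0∷[]≈[] ⟩
  p + []                    ≈⟨ +-identityʳ p ⟩
  p                         ∎
  where open ≈-Reasoning ≈-setoid

ℤ[x]-commutativeRing : CommutativeRing 0ℓ 0ℓ
ℤ[x]-commutativeRing = record
  { Carrier           = ℤ[x]
  ; _≈_               = _≈_
  ; _+_               = _+_
  ; _*_               = _*_
  ; -_                = -_
  ; 0#                = []
  ; 1#                = C ℤ.1ℤ
  ; isCommutativeRing = record
    { isRing = record
      { +-isAbelianGroup = AbelianGroup.isAbelianGroup +-abelianGroup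
      ; *-cong           = *-cong
      ; *-assoc          = *-assoc
      ; *-identity       = *-identityˡ , λ p → ≈-trans (*-comm p (C ℤ.1ℤ)) (*-identityˡ p)
      ; distrib          = *-distribˡ-+ , *-distribʳ-+
      }
    ; *-comm = *-comm
    }
  }

open SemiringSum (CommutativeRing.semiring ℤ[x]-commutativeRing) using (*-distribˡ-sum)

-- Gives the ring solver integer coefficients: `con a` denotes `C a`, coefficients are compared in
-- ℤ, and initial values such as `F 0` and `F 1` can be entered as constants.
C-homo : CommutativeRing.rawRing ℤ.+-*-commutativeRing
         -Raw-AlmostCommutative⟶ fromCommutativeRing ℤ[x]-commutativeRing
C-homo = record
  { ⟦_⟧    = C
  ; +-homo = λ _ _ → ≈-refl
  ; *-homo = λ a b → ≡.sym (ℤ.+-identityʳ (a ℤ.* b)) ∷-cong ≈-refl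
  ; -‿homo = λ _ → ≈-refl
  ; 0-homo = 0∷[]≈[]
  ; 1-homo = ≈-refl
  }

open RingSolver (CommutativeRing.rawRing ℤ.+-*-commutativeRing)
  (fromCommutativeRing ℤ[x]-commutativeRing) C-homo
  (λ a b → Maybe.map (≈-reflexive ∘ cong C) (dec⇒weaklyDec ℤ._≟_ a b))
  using (solve; con; _:+_; _:*_; _:-_; :-_; _:^_; _:=_)

-- Second order linear recurrences

-- A record rather than a function type, so that a, b and s can be inferred.
record Recurrence (a b : ℤ[x]) (s : ℕ → ℤ[x]) : Set where
  constructor mkRec
  field
    step : ∀ m → s (2 ℕ.+ m) ≈ a * s (1 ℕ.+ m) + b * s m

open Recurrence

Recurrence-resp : ∀ {a a′ b b′ s} → a ≈ a′ → b ≈ b′ → Recurrence a b s → Recurrence a′ b′ s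
Recurrence-resp a≈a′ b≈b′ rec = mkRec λ m →
  ≈-trans (step rec m) (+-cong (*-cong a≈a′ ≈-refl) (*-cong b≈b′ ≈-refl))

T-rec : Recurrence (C (+ 2) * X) (- C (+ 1)) T
T-rec = mkRec λ m → solve 3 (λ x t₁ t₀ → con (+ 2) :* x :* t₁ :- t₀
    := con (+ 2) :* x :* t₁ :+ (:- con (+ 1)) :* t₀) ≈-refl X (T (1 ℕ.+ m)) (T m)

U-rec : Recurrence (C (+ 2) * X) (- C (+ 1)) U
U-rec = mkRec λ m → solve 3 (λ x u₁ u₀ → con (+ 2) :* x :* u₁ :- u₀
    := con (+ 2) :* x :* u₁ :+ (:- con (+ 1)) :* u₀) ≈-refl X (U (1 ℕ.+ m)) (U m)

F-rec : Recurrence X (C (+ 1)) F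
F-rec = mkRec λ m → solve 3 (λ x f₁ f₀ → x :* f₁ :+ f₀ := x :* f₁ :+ con (+ 1) :* f₀)
  ≈-refl X (F (1 ℕ.+ m)) (F m)

-- If α and β are the characteristic roots, then α + β = a and αβ = -b. The bisection has roots α²
-- and β², with sum a² + 2b and product b².
bisection : ∀ {a b s} → Recurrence a b s →
  Recurrence (a * a + C (+ 2) * b) (- (b * b)) (λ m → s (2 ℕ.* m))
bisection {a} {b} {s} rec = mkRec λ m → let n = 2 ℕ.* m in begin
  s (2 ℕ.* (2 ℕ.+ m))
    ≡⟨ cong s (ℕ.*-distribˡ-+ 2 2 m) ⟩
  s (4 ℕ.+ n)
    ≈⟨ step rec (2 ℕ.+ n) ⟩
  a * s (3 ℕ.+ n) + b * s (2 ℕ.+ n)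
    ≈⟨ +-cong (*-congˡ a (step rec (1 ℕ.+ n))) ≈-refl ⟩
  a * (a * s (2 ℕ.+ n) + b * s (1 ℕ.+ n)) + b * s (2 ℕ.+ n)
    -- Adding and subtracting `b * b * s n` completes the odd-index term to a right-hand side of the
    -- recurrence, which the next step folds into `s (2 ℕ.+ n)`.
    ≈⟨ solve 5 (λ a b s₂ s₁ s₀ → a :* (a :* s₂ :+ b :* s₁) :+ b :* s₂
         := (a :* a :+ b) :* s₂ :+ b :* (a :* s₁ :+ b :* s₀) :+ (:- (b :* b)) :* s₀)
         ≈-refl a b (s (2 ℕ.+ n)) (s (1 ℕ.+ n)) (s n) ⟩
  (a * a + b) * s (2 ℕ.+ n) + b * (a * s (1 ℕ.+ n) + b * s n) + (- (b * b)) * s n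
    ≈⟨ +-cong (+-cong (≈-refl {(a * a + b) * s (2 ℕ.+ n)}) (*-congˡ b (step rec n))) ≈-refl ⟨
  (a * a + b) * s (2 ℕ.+ n) + b * s (2 ℕ.+ n) + (- (b * b)) * s n
    ≈⟨ solve 4 (λ a b s₂ s₀ → (a :* a :+ b) :* s₂ :+ b :* s₂ :+ (:- (b :* b)) :* s₀
         := (a :* a :+ con (+ 2) :* b) :* s₂ :+ (:- (b :* b)) :* s₀)
         ≈-refl a b (s (2 ℕ.+ n)) (s n) ⟩
  (a * a + C (+ 2) * b) * s (2 ℕ.+ n) + (- (b * b)) * s n
    ≡⟨ cong (λ j → (a * a + C (+ 2) * b) * s j + (- (b * b)) * s n) (ℕ.*-distribˡ-+ 2 1 m) ⟨
  (a * a + C (+ 2) * b) * s (2 ℕ.* (1 ℕ.+ m)) + (- (b * b)) * s n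
    ∎
  where
  open ≈-Reasoning ≈-setoid

Chebyshev-bisection : ∀ {s} → Recurrence (C (+ 2) * X) (- C (+ 1)) s →
  Recurrence (C (+ 4) * X ^ 2 - C (+ 2)) (- C (+ 1)) (λ m → s (2 ℕ.* m))
Chebyshev-bisection rec = Recurrence-resp
  (solve 1 (λ x → con (+ 2) :* x :* (con (+ 2) :* x) :+ con (+ 2) :* (:- con (+ 1))
    := con (+ 4) :* x :^ 2 :- con (+ 2)) ≈-refl X)
  ≈-refl
  (bisection rec)

Fibonacci-bisection : ∀ {s} → Recurrence X (C (+ 1)) s →
  Recurrence (X ^ 2 + C (+ 2)) (- C (+ 1)) (λ m → s (2 ℕ.* m))
Fibonacci-bisection rec = Recurrence-resp
  (solve 1 (λ x → x :* x :+ con (+ 2) :* con (+ 1) := x :^ 2 :+ con (+ 2)) ≈-refl X)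
  ≈-refl
  (bisection rec)

infixr 5 _◁_

-- Extends a sequence to index -1 while keeping ℕ as index set. The boundary terms of the
-- telescoping sum then involve the value at -1.
_◁_ : ℤ[x] → (ℕ → ℤ[x]) → ℕ → ℤ[x]
(p ◁ s) zero    = p
(p ◁ s) (suc m) = s m

◁-rec : ∀ {a b p s} → s 1 ≈ a * s 0 + b * p → Recurrence a b s → Recurrence a b (p ◁ s)
◁-rec s₁≈ rec = mkRec λ where
  zero    → s₁≈
  (suc m) → step rec m

shift : ∀ {a b s} → Recurrence a b s → Recurrence a b (s ∘ suc)
shift rec = mkRec λ m → step rec (suc m)

-- Convolutions

-- The points (m+1, k) and (m, k+1) are neighbours on the antidiagonal of sum N, and the sum walks
-- along it from (N, 0) to (0, N). The condition `suc (m ℕ.+ k) ≡ N` replaces a truncated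
-- subtraction for m.
telescope : ∀ (W : ℕ → ℕ → ℤ[x]) N (g : ℕ → ℤ[x]) →
  (∀ m k → suc (m ℕ.+ k) ≡ N → g k ≈ W (suc m) k - W m (suc k)) →
  sum {n = N} (λ i → g (toℕ i)) ≈ W N 0 - W 0 N
telescope W zero    g g≈ = ≈-sym (-‿inverseʳ (W 0 0))
telescope W (suc N) g g≈ = begin
  g 0 + sum {n = N} (λ i → g (suc (toℕ i)))
    ≈⟨ +-cong (g≈ N 0 (cong suc (ℕ.+-identityʳ N)))
         (telescope (λ m k → W m (suc k)) N (g ∘ suc)
           (λ m k eq → g≈ m (suc k) (cong suc (≡.trans (ℕ.+-suc m k) eq)))) ⟩
  (W (suc N) 0 - W N 1) + (W N 1 - W 0 (suc N))
    ≈⟨ solve 3 (λ u v w → (u :- v) :+ (v :- w) := u :- w)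
         ≈-refl (W (suc N) 0) (W N 1) (W 0 (suc N)) ⟩
  W (suc N) 0 - W 0 (suc N)
    ∎
  where open ≈-Reasoning ≈-setoid

convolution : ∀ {c d Q} → Recurrence c d Q → ∀ (P : ℕ → ℤ[x]) N (g : ℕ → ℤ[x]) →
  (∀ m k → suc (m ℕ.+ k) ≡ N →
    g k ≈ (P (2 ℕ.+ m) - c * P (1 ℕ.+ m) - d * P m) * Q (1 ℕ.+ k)) →
  sum {n = N} (λ i → g (toℕ i))
    ≈ (P (1 ℕ.+ N) * Q 1 + d * P N * Q 0) - (P 1 * Q (1 ℕ.+ N) + d * P 0 * Q N)
convolution {c} {d} {Q} Q-rec P N g g≈ = telescope W N g λ m k eq → begin
  g k
    ≈⟨ g≈ m k eq ⟩
  (P (2 ℕ.+ m) - c * P (1 ℕ.+ m) - d * P m) * Q (1 ℕ.+ k)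
    -- The weight d in `W` is chosen so that d P_{m+1} Q_k, which also arises from expanding
    -- Q_{k+2}, cancels.
    ≈⟨ solve 7 (λ c d p₂ p₁ p₀ q₁ q₀ → (p₂ :- c :* p₁ :- d :* p₀) :* q₁
         := (p₂ :* q₁ :+ d :* p₁ :* q₀) :- (p₁ :* (c :* q₁ :+ d :* q₀) :+ d :* p₀ :* q₁))
         ≈-refl c d (P (2 ℕ.+ m)) (P (1 ℕ.+ m)) (P m) (Q (1 ℕ.+ k)) (Q k) ⟩
  W (suc m) k - (P (1 ℕ.+ m) * (c * Q (1 ℕ.+ k) + d * Q k) + d * P m * Q (1 ℕ.+ k))
    ≈⟨ +-cong (≈-refl {W (suc m) k}) (-‿cong (+-cong (*-congˡ (P (1 ℕ.+ m)) (step Q-rec k)) ≈-refl)) ⟨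
  W (suc m) k - W m (suc k)
    ∎
  where
  open ≈-Reasoning ≈-setoid
  W : ℕ → ℕ → ℤ[x]
  W m k = P (1 ℕ.+ m) * Q (1 ℕ.+ k) + d * P m * Q k

-- Convolution with Q = F, c = x, d = 1: the recurrence of P turns P_{m+2} - x P_{m+1} - P_m into
-- the combination required of `h`. Keeping `h` abstract serves both ways in which the first four
-- identities write their indices.
convolution-F : ∀ {P} → Recurrence (C (+ 4) * X ^ 2 - C (+ 2)) (- C (+ 1)) P →
  ∀ N (h : ℕ → ℤ[x]) →
  (∀ m → h (2 ℕ.+ m) ≈ (C (+ 4) * X ^ 2 - X - C (+ 2)) * P (1 ℕ.+ m) - C (+ 2) * P m) →
  P 0 * F (suc N) + (P 1 - X * P 0) * F N
    ≈ P N - ∑[ k from 1 to (N ∸ 1) ] (h (suc N ∸ k) * F k)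
-- The sum is empty here, and `F 1` = 1, `F 0` = 0 leave only `P 0`.
convolution-F {P} P-rec zero h h≈ = ≈-trans
  (solve 3 (λ x p₀ p₁ → p₀ :* con (+ 1) :+ (p₁ :- x :* p₀) :* con (+ 0) := p₀)
    ≈-refl X (P 0) (P 1))
  (≈-sym (+-identityʳ (P 0)))
convolution-F {P} P-rec (suc M) h h≈ = begin
  P 0 * F (2 ℕ.+ M) + (P 1 - X * P 0) * F (1 ℕ.+ M)
    -- The upper boundary term is P_{M+1} because `F 1` = 1 and `F 0` = 0. It cancels the leading
    -- term, and the lower boundary term is the left-hand side.
    ≈⟨ solve 7 (λ x p₀ p₁ pₘ pₘ₊₁ f₀ f₁ →
         p₀ :* (x :* f₁ :+ f₀) :+ (p₁ :- x :* p₀) :* f₁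
         := pₘ₊₁ :- ((pₘ₊₁ :* con (+ 1) :+ con (+ 1) :* pₘ :* con (+ 0))
                     :- (p₁ :* f₁ :+ con (+ 1) :* p₀ :* f₀)))
         ≈-refl X (P 0) (P 1) (P M) (P (suc M)) (F M) (F (1 ℕ.+ M)) ⟩
  P (suc M) - ((P (1 ℕ.+ M) * F 1 + C (+ 1) * P M * F 0)
               - (P 1 * F (1 ℕ.+ M) + C (+ 1) * P 0 * F M))
    ≈⟨ +-cong (≈-refl {P (suc M)}) (-‿cong (convolution F-rec P M g g≈)) ⟨
  P (suc M) - ∑[ k from 1 to M ] (h (suc (suc M) ∸ k) * F k)
    ∎
  where
  open ≈-Reasoning ≈-setoid
  g : ℕ → ℤ[x]
  -- The sum starts at 1, so `g k` is its summand at k + 1.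
  g k = h (suc M ∸ k) * F (1 ℕ.+ k)
  h≈P : ∀ m → h (2 ℕ.+ m) ≈ P (2 ℕ.+ m) - X * P (1 ℕ.+ m) - C (+ 1) * P m
  h≈P m = begin
    h (2 ℕ.+ m)
      ≈⟨ h≈ m ⟩
    (C (+ 4) * X ^ 2 - X - C (+ 2)) * P (1 ℕ.+ m) - C (+ 2) * P m
      ≈⟨ solve 3 (λ x p₀ p₁ → (con (+ 4) :* x :^ 2 :- x :- con (+ 2)) :* p₁ :- con (+ 2) :* p₀
           := ((con (+ 4) :* x :^ 2 :- con (+ 2)) :* p₁ :+ (:- con (+ 1)) :* p₀)
              :- x :* p₁ :- con (+ 1) :* p₀)
           ≈-refl X (P m) (P (1 ℕ.+ m)) ⟩
    ((C (+ 4) * X ^ 2 - C (+ 2)) * P (1 ℕ.+ m) + (- C (+ 1)) * P m)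
      - X * P (1 ℕ.+ m) - C (+ 1) * P m
      ≈⟨ +-cong (+-cong (step P-rec m) ≈-refl) ≈-refl ⟨
    P (2 ℕ.+ m) - X * P (1 ℕ.+ m) - C (+ 1) * P m
      ∎
  g≈ : ∀ m k → suc (m ℕ.+ k) ≡ M →
    g k ≈ (P (2 ℕ.+ m) - X * P (1 ℕ.+ m) - C (+ 1) * P m) * F (1 ℕ.+ k)
  g≈ m k ≡.refl = *-cong
    (≈-trans (≈-reflexive (cong h (ℕ.m+n∸n≡m (2 ℕ.+ m) k))) (h≈P m)) ≈-refl

-- Two recurrences that differ in the coefficient a only: each summand of the
-- telescoping sum collapses to e times a single product.
convolution-∝ : ∀ e {c d P Q} → Recurrence (c + e) d P → Recurrence c d Q →
  ∀ N (g : ℕ → ℤ[x]) → (∀ m k → suc (m ℕ.+ k) ≡ N → g k ≈ P (1 ℕ.+ m) * Q (1 ℕ.+ k)) →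
  e * sum {n = N} (λ i → g (toℕ i))
    ≈ (P (1 ℕ.+ N) * Q 1 + d * P N * Q 0) - (P 1 * Q (1 ℕ.+ N) + d * P 0 * Q N)
convolution-∝ e {c} {d} {P} {Q} P-rec Q-rec N g g≈ = ≈-trans
  (*-distribˡ-sum {N} e (λ i → g (toℕ i)))
  (convolution Q-rec P N (λ k → e * g k) λ m k eq → begin
    e * g k
      ≈⟨ *-congˡ e (g≈ m k eq) ⟩
    e * (P (1 ℕ.+ m) * Q (1 ℕ.+ k))
      ≈⟨ solve 6 (λ c d e p₁ p₀ q → e :* (p₁ :* q)
           := (((c :+ e) :* p₁ :+ d :* p₀) :- c :* p₁ :- d :* p₀) :* q)
           ≈-refl c d e (P (1 ℕ.+ m)) (P m) (Q (1 ℕ.+ k)) ⟩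
    (((c + e) * P (1 ℕ.+ m) + d * P m) - c * P (1 ℕ.+ m) - d * P m) * Q (1 ℕ.+ k)
      ≈⟨ *-cong (+-cong (+-cong (step P-rec m) ≈-refl) ≈-refl) ≈-refl ⟨
    (P (2 ℕ.+ m) - c * P (1 ℕ.+ m) - d * P m) * Q (1 ℕ.+ k)
      ∎)
  where open ≈-Reasoning ≈-setoid

-- Convolutions with the bisections of the Fibonacci polynomials

2*[1+n]∸1 : ∀ n → 2 ℕ.* suc n ∸ 1 ≡ 1 ℕ.+ 2 ℕ.* n
2*[1+n]∸1 n = cong (_∸ 1) (ℕ.*-suc 2 n)

2*[1+n]∸2 : ∀ n → 2 ℕ.* suc n ∸ 2 ≡ 2 ℕ.* n
2*[1+n]∸2 n = cong (_∸ 2) (ℕ.*-suc 2 n)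

-- The prepended 1 is F₋₁, since F₁ = x F₀ + F₋₁.
F-odd-rec : Recurrence (X ^ 2 + C (+ 2)) (- C (+ 1)) (C (+ 1) ◁ λ k → F (1 ℕ.+ 2 ℕ.* k))
F-odd-rec = ◁-rec
  (solve 1 (λ x → x :* (x :* con (+ 1) :+ con (+ 0)) :+ con (+ 1)
    := (x :^ 2 :+ con (+ 2)) :* con (+ 1) :+ (:- con (+ 1)) :* con (+ 1)) ≈-refl X)
  (Fibonacci-bisection (shift F-rec))

-- Both sequences are extended to the left by one term, so the sum starts with F₁. Since F₁ = F₋₁ =
-- 1 and d = -1, the upper boundary term is P_{N+1} - P_N.
convolution-F-odd : ∀ e {p P} → Recurrence (X ^ 2 + C (+ 2) + e) (- C (+ 1)) (p ◁ P) →
  ∀ N (g : ℕ → ℤ[x]) → (∀ m k → m ℕ.+ k ≡ N → g k ≈ P m * F (2 ℕ.* k ℕ.+ 1)) →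
  P 0 * F (2 ℕ.* suc N ℕ.+ 1) - p * F (2 ℕ.* suc N ∸ 1)
    ≈ P (suc N) - P N - e * ∑[ k from 0 to N ] (g k)
convolution-F-odd e {p} {P} P-rec N g g≈ = begin
  P 0 * F (2 ℕ.* suc N ℕ.+ 1) - p * F (2 ℕ.* suc N ∸ 1)
    ≡⟨ cong₂ (λ i j → P 0 * F i - p * F j) (ℕ.+-comm (2 ℕ.* suc N) 1) (2*[1+n]∸1 N) ⟩
  P 0 * f₁ - p * f₀
    ≈⟨ solve 6 (λ p p₀ pₙ pₙ₊₁ f₀ f₁ → p₀ :* f₁ :- p :* f₀
         := pₙ₊₁ :- pₙ :- ((pₙ₊₁ :* con (+ 1) :+ (:- con (+ 1)) :* pₙ :* con (+ 1))
                           :- (p₀ :* f₁ :+ (:- con (+ 1)) :* p :* f₀)))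
         ≈-refl p (P 0) (P N) (P (suc N)) f₀ f₁ ⟩
  P (suc N) - P N - ((P (suc N) * F 1 + (- C (+ 1)) * P N * C (+ 1))
                     - (P 0 * f₁ + (- C (+ 1)) * p * f₀))
    ≈⟨ +-cong (≈-refl {P (suc N) - P N})
         (-‿cong (convolution-∝ e P-rec F-odd-rec (suc N) g λ m k eq →
           ≈-trans (g≈ m k (ℕ.suc-injective eq))
                   (≈-reflexive (cong (λ i → P m * F i) (ℕ.+-comm (2 ℕ.* k) 1))))) ⟨
  P (suc N) - P N - e * ∑[ k from 0 to N ] (g k)
    ∎
  where
  open ≈-Reasoning ≈-setoid
  f₀ = F (1 ℕ.+ 2 ℕ.* N)
  f₁ = F (1 ℕ.+ 2 ℕ.* suc N)

-- Only P is extended: the even bisection starts at F₀ = 0, and F₂ = x makes the upper boundary term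
-- x P_N.
convolution-F-even : ∀ e {p P} → Recurrence (X ^ 2 + C (+ 2) + e) (- C (+ 1)) (p ◁ P) →
  ∀ N (g : ℕ → ℤ[x]) → (∀ m k → suc (m ℕ.+ k) ≡ N → g (suc k) ≈ P m * F (2 ℕ.* suc k)) →
  P 0 * F (2 ℕ.* suc N) - p * F (2 ℕ.* suc N ∸ 2)
    ≈ X * P N - e * ∑[ k from 1 to N ] (g k)
convolution-F-even e {p} {P} P-rec N g g≈ = begin
  P 0 * f₁ - p * F (2 ℕ.* suc N ∸ 2)
    ≡⟨ cong (λ i → P 0 * f₁ - p * F i) (2*[1+n]∸2 N) ⟩
  P 0 * f₁ - p * f₀
    -- `(p ◁ P) N` does not reduce for a variable `N`; it enters as an atom and vanishes against
    -- `F 0`.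
    ≈⟨ solve 7 (λ x p p₀ pₙ₋₁ pₙ f₀ f₁ → p₀ :* f₁ :- p :* f₀
         := x :* pₙ :- ((pₙ :* (x :* con (+ 1) :+ con (+ 0)) :+ (:- con (+ 1)) :* pₙ₋₁ :* con (+ 0))
                        :- (p₀ :* f₁ :+ (:- con (+ 1)) :* p :* f₀)))
         ≈-refl X p (P 0) ((p ◁ P) N) (P N) f₀ f₁ ⟩
  X * P N - ((P N * F 2 + (- C (+ 1)) * (p ◁ P) N * F 0) - (P 0 * f₁ + (- C (+ 1)) * p * f₀))
    ≈⟨ +-cong (≈-refl {X * P N})
         (-‿cong (convolution-∝ e P-rec (Fibonacci-bisection F-rec) N (g ∘ suc) g≈)) ⟨
  X * P N - e * ∑[ k from 1 to N ] (g k)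
    ∎
  where
  open ≈-Reasoning ≈-setoid
  f₀ = F (2 ℕ.* N)
  f₁ = F (2 ℕ.* suc N)

-- Chebyshev sequences extended by one term to the left

Chebyshev-bisection-◁ : ∀ {p s} → s 2 ≈ (C (+ 4) * X ^ 2 - C (+ 2)) * s 0 + (- C (+ 1)) * p →
  Recurrence (C (+ 2) * X) (- C (+ 1)) s →
  Recurrence (X ^ 2 + C (+ 2) + (C (+ 3) * X ^ 2 - C (+ 4))) (- C (+ 1)) (p ◁ λ m → s (2 ℕ.* m))
Chebyshev-bisection-◁ s₂≈ rec = Recurrence-resp
  -- The factor 3x² - 4 of the fifth to eighth identities is the difference of the two bisection
  -- coefficients 4x² - 2 and x² + 2.
  (solve 1 (λ x → con (+ 4) :* x :^ 2 :- con (+ 2)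
    := x :^ 2 :+ con (+ 2) :+ (con (+ 3) :* x :^ 2 :- con (+ 4))) ≈-refl X)
  ≈-refl
  (◁-rec s₂≈ (Chebyshev-bisection rec))

Chebyshev-◁ : ∀ {p s} → s 1 ≈ C (+ 2) * X * s 0 + (- C (+ 1)) * p →
  Recurrence (C (+ 2) * X) (- C (+ 1)) s →
  Recurrence (X ^ 2 + C (+ 2) + (- (X ^ 2 - C (+ 2) * X + C (+ 2)))) (- C (+ 1)) (p ◁ s)
Chebyshev-◁ s₁≈ rec = Recurrence-resp
  -- Here the full Chebyshev sequence meets a Fibonacci bisection: 2x - (x² + 2) is minus the factor
  -- of the last four identities.
  (solve 1 (λ x → con (+ 2) :* x
    := x :^ 2 :+ con (+ 2) :+ (:- (x :^ 2 :- con (+ 2) :* x :+ con (+ 2)))) ≈-refl X)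
  ≈-refl
  (◁-rec s₁≈ rec)

-- The extensions to negative indices: T₋₂ = 2x² - 1, U₋₂ = -1, T₋₁ = x, U₋₁ = 0.

T-even-◁ : Recurrence (X ^ 2 + C (+ 2) + (C (+ 3) * X ^ 2 - C (+ 4))) (- C (+ 1))
  ((C (+ 2) * X ^ 2 - C (+ 1)) ◁ λ m → T (2 ℕ.* m))
T-even-◁ = Chebyshev-bisection-◁
  (solve 1 (λ x → con (+ 2) :* x :* x :- con (+ 1)
    := (con (+ 4) :* x :^ 2 :- con (+ 2)) :* con (+ 1)
       :+ (:- con (+ 1)) :* (con (+ 2) :* x :^ 2 :- con (+ 1))) ≈-refl X)
  T-rec

U-even-◁ : Recurrence (X ^ 2 + C (+ 2) + (C (+ 3) * X ^ 2 - C (+ 4))) (- C (+ 1))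
  ((- C (+ 1)) ◁ λ m → U (2 ℕ.* m))
U-even-◁ = Chebyshev-bisection-◁
  (solve 1 (λ x → con (+ 2) :* x :* (con (+ 2) :* x) :- con (+ 1)
    := (con (+ 4) :* x :^ 2 :- con (+ 2)) :* con (+ 1)
       :+ (:- con (+ 1)) :* (:- con (+ 1))) ≈-refl X)
  U-rec

T-odd-◁ : Recurrence (X ^ 2 + C (+ 2) + (C (+ 3) * X ^ 2 - C (+ 4))) (- C (+ 1))
  (X ◁ λ m → T (1 ℕ.+ 2 ℕ.* m))
T-odd-◁ = Chebyshev-bisection-◁
  (solve 1 (λ x → con (+ 2) :* x :* (con (+ 2) :* x :* x :- con (+ 1)) :- x
    := (con (+ 4) :* x :^ 2 :- con (+ 2)) :* x :+ (:- con (+ 1)) :* x) ≈-refl X)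
  (shift T-rec)

U-odd-◁ : Recurrence (X ^ 2 + C (+ 2) + (C (+ 3) * X ^ 2 - C (+ 4))) (- C (+ 1))
  (C (+ 0) ◁ λ m → U (1 ℕ.+ 2 ℕ.* m))
U-odd-◁ = Chebyshev-bisection-◁
  (solve 1 (λ x → con (+ 2) :* x :* (con (+ 2) :* x :* (con (+ 2) :* x) :- con (+ 1)) :- con (+ 2) :* x
    := (con (+ 4) :* x :^ 2 :- con (+ 2)) :* (con (+ 2) :* x)
       :+ (:- con (+ 1)) :* con (+ 0)) ≈-refl X)
  (shift U-rec)

T-◁ : Recurrence (X ^ 2 + C (+ 2) + (- (X ^ 2 - C (+ 2) * X + C (+ 2)))) (- C (+ 1)) (X ◁ T)
T-◁ = Chebyshev-◁
  (solve 1 (λ x → x := con (+ 2) :* x :* con (+ 1) :+ (:- con (+ 1)) :* x) ≈-refl X)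
  T-rec

U-◁ : Recurrence (X ^ 2 + C (+ 2) + (- (X ^ 2 - C (+ 2) * X + C (+ 2)))) (- C (+ 1)) (C (+ 0) ◁ U)
U-◁ = Chebyshev-◁
  (solve 1 (λ x → con (+ 2) :* x
    := con (+ 2) :* x :* con (+ 1) :+ (:- con (+ 1)) :* con (+ 0)) ≈-refl X)
  U-rec

-- Restores the plus sign in the last four identities, where e is a negated polynomial.
p-[-q]r≈p+qr : ∀ p q r → p - (- q) * r ≈ p + q * r
p-[-q]r≈p+qr = solve 3 (λ p q r → p :- (:- q) :* r := p :+ q :* r) ≈-refl

-- The twelve identities

theorem3 : (n : ℕ) → n ℕ.≥ 1 →
    (X * F n + (C (+ 4) * X ^ 3 - X ^ 2 - C (+ 3) * X) * F (n ∸ 1)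
      ≈ T (2 ℕ.* n ∸ 1)
        - ∑[ k from 1 to (n ∸ 2) ] (((C (+ 4) * X ^ 2 - X - C (+ 2)) * T (2 ℕ.* (n ∸ k) ∸ 1) - C (+ 2) * T (2 ℕ.* (n ∸ k) ∸ 3)) * F k))
  × (C (+ 2) * X * F n + (C (+ 8) * X ^ 3 - C (+ 2) * X ^ 2 - C (+ 4) * X) * F (n ∸ 1)
      ≈ U (2 ℕ.* n ∸ 1)
        - ∑[ k from 1 to (n ∸ 2) ] (((C (+ 4) * X ^ 2 - X - C (+ 2)) * U (2 ℕ.* (n ∸ k) ∸ 1) - C (+ 2) * U (2 ℕ.* (n ∸ k) ∸ 3)) * F k))
  × (F n + (C (+ 2) * X ^ 2 - X - C (+ 1)) * F (n ∸ 1)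
      ≈ T (2 ℕ.* n ∸ 2)
        - ∑[ k from 1 to (n ∸ 2) ] (((C (+ 4) * X ^ 2 - X - C (+ 2)) * T (2 ℕ.* (n ∸ k ∸ 1)) - C (+ 2) * T (2 ℕ.* (n ∸ k ∸ 2))) * F k))
  × (F n + (C (+ 4) * X ^ 2 - X - C (+ 1)) * F (n ∸ 1)
      ≈ U (2 ℕ.* n ∸ 2)
        - ∑[ k from 1 to (n ∸ 2) ] (((C (+ 4) * X ^ 2 - X - C (+ 2)) * U (2 ℕ.* (n ∸ k ∸ 1)) - C (+ 2) * U (2 ℕ.* (n ∸ k ∸ 2))) * F k))
  × (F (2 ℕ.* n ℕ.+ 1) - (C (+ 2) * X ^ 2 - C (+ 1)) * F (2 ℕ.* n ∸ 1)
      ≈ T (2 ℕ.* n) - T (2 ℕ.* n ∸ 2)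
        - (C (+ 3) * X ^ 2 - C (+ 4)) * ∑[ k from 0 to (n ∸ 1) ] (T (2 ℕ.* (n ∸ k ∸ 1)) * F (2 ℕ.* k ℕ.+ 1)))
  × (F (2 ℕ.* n ℕ.+ 1) + F (2 ℕ.* n ∸ 1)
      ≈ U (2 ℕ.* n) - U (2 ℕ.* n ∸ 2)
        - (C (+ 3) * X ^ 2 - C (+ 4)) * ∑[ k from 0 to (n ∸ 1) ] (U (2 ℕ.* (n ∸ k ∸ 1)) * F (2 ℕ.* k ℕ.+ 1)))
  × (X ^ 2 * F (2 ℕ.* n ∸ 1)
      ≈ X * T (2 ℕ.* n ∸ 1)
        - (C (+ 3) * X ^ 2 - C (+ 4)) * ∑[ k from 1 to (n ∸ 1) ] (T (2 ℕ.* (n ∸ k) ∸ 1) * F (2 ℕ.* k)))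
  × (C (+ 2) * X * F (2 ℕ.* n)
      ≈ X * U (2 ℕ.* n ∸ 1)
        - (C (+ 3) * X ^ 2 - C (+ 4)) * ∑[ k from 1 to (n ∸ 1) ] (U (2 ℕ.* (n ∸ k) ∸ 1) * F (2 ℕ.* k)))
  × (F (2 ℕ.* n ℕ.+ 1) - X * F (2 ℕ.* n ∸ 1)
      ≈ T n - T (n ∸ 1)
        + (X ^ 2 - C (+ 2) * X + C (+ 2)) * ∑[ k from 0 to (n ∸ 1) ] (T (n ∸ 1 ∸ k) * F (2 ℕ.* k ℕ.+ 1)))
  × (F (2 ℕ.* n ℕ.+ 1)
      ≈ U n - U (n ∸ 1)
        + (X ^ 2 - C (+ 2) * X + C (+ 2)) * ∑[ k from 0 to (n ∸ 1) ] (U (n ∸ 1 ∸ k) * F (2 ℕ.* k ℕ.+ 1)))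
  × (F (2 ℕ.* n) - X * F (2 ℕ.* n ∸ 2)
      ≈ X * T (n ∸ 1)
        + (X ^ 2 - C (+ 2) * X + C (+ 2)) * ∑[ k from 1 to (n ∸ 1) ] (T (n ∸ 1 ∸ k) * F (2 ℕ.* k)))
  × (F (2 ℕ.* n)
      ≈ X * U (n ∸ 1)
        + (X ^ 2 - C (+ 2) * X + C (+ 2)) * ∑[ k from 1 to (n ∸ 1) ] (U (n ∸ 1 ∸ k) * F (2 ℕ.* k)))
theorem3 (suc N) _ =
    ≈-trans
      -- In the first four identities the coefficient of F_{n-1} is s₃ - x s₁ or s₂ - x s₀ with s =
      -- T or U; the solver sees these values unfolded.
      (solve 3 (λ x f₁ f₀ →
        x :* f₁ :+ (con (+ 4) :* x :^ 3 :- x :^ 2 :- con (+ 3) :* x) :* f₀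
        := x :* f₁ :+ ((con (+ 2) :* x :* (con (+ 2) :* x :* x :- con (+ 1)) :- x) :- x :* x) :* f₀)
        ≈-refl X (F (suc N)) (F N))
      (odd-F T T-rec)
  , ≈-trans
      (solve 3 (λ x f₁ f₀ →
        con (+ 2) :* x :* f₁ :+ (con (+ 8) :* x :^ 3 :- con (+ 2) :* x :^ 2 :- con (+ 4) :* x) :* f₀
        := con (+ 2) :* x :* f₁
           :+ ((con (+ 2) :* x :* (con (+ 2) :* x :* (con (+ 2) :* x) :- con (+ 1)) :- con (+ 2) :* x)
               :- x :* (con (+ 2) :* x)) :* f₀)
        ≈-refl X (F (suc N)) (F N))
      (odd-F U U-rec)
  , ≈-trans
      (solve 3 (λ x f₁ f₀ →
        f₁ :+ (con (+ 2) :* x :^ 2 :- x :- con (+ 1)) :* f₀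
        := con (+ 1) :* f₁ :+ ((con (+ 2) :* x :* x :- con (+ 1)) :- x :* con (+ 1)) :* f₀)
        ≈-refl X (F (suc N)) (F N))
      (even-F T T-rec)
  , ≈-trans
      (solve 3 (λ x f₁ f₀ →
        f₁ :+ (con (+ 4) :* x :^ 2 :- x :- con (+ 1)) :* f₀
        := con (+ 1) :* f₁
           :+ ((con (+ 2) :* x :* (con (+ 2) :* x) :- con (+ 1)) :- x :* con (+ 1)) :* f₀)
        ≈-refl X (F (suc N)) (F N))
      (even-F U U-rec)
  , ≈-trans
      -- From here on the left-hand side is brought to the form of a boundary term: `q` is T₋₂, and
      -- U₋₂ = -1 explains the plus sign of the sixth identity.
      (solve 3 (λ q f₂ f₀ → f₂ :- q :* f₀ := con (+ 1) :* f₂ :- q :* f₀)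
        ≈-refl (C (+ 2) * X ^ 2 - C (+ 1)) f₂ f₀)
      (even-F-odd T T-even-◁)
  , ≈-trans
      (solve 2 (λ f₂ f₀ → f₂ :+ f₀ := con (+ 1) :* f₂ :- (:- con (+ 1)) :* f₀) ≈-refl f₂ f₀)
      (even-F-odd U U-even-◁)
  , ≈-trans
      -- By the Fibonacci recurrence x F_{2n-1} = F_{2n} - F_{2n-2}, so the left-hand side is T₁
      -- F_{2n} - T₋₁ F_{2n-2}.
      (begin
        X ^ 2 * f₀
          ≡⟨ cong (λ i → X ^ 2 * F i) (2*[1+n]∸1 N) ⟩
        X ^ 2 * F (1 ℕ.+ 2 ℕ.* N)
          ≈⟨ solve 3 (λ x f₁ f₀ → x :^ 2 :* f₁ := x :* (x :* f₁ :+ f₀) :- x :* f₀)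
               ≈-refl X (F (1 ℕ.+ 2 ℕ.* N)) (F (2 ℕ.* N)) ⟩
        X * F (2 ℕ.+ 2 ℕ.* N) - X * F (2 ℕ.* N)
          ≡⟨ cong₂ (λ i j → X * F i - X * F j) (ℕ.*-suc 2 N) (2*[1+n]∸2 N) ⟨
        X * f₁ - X * f₋₁
          ∎)
      (odd-F-even T T-odd-◁)
  , ≈-trans
      -- The invisible term has coefficient U₋₁ = 0, as in the tenth and twelfth identities.
      (solve 3 (λ x f₁ f₋₁ → con (+ 2) :* x :* f₁ := con (+ 2) :* x :* f₁ :- con (+ 0) :* f₋₁)
        ≈-refl X f₁ f₋₁)
      (odd-F-even U U-odd-◁)
  , ≈-trans
      (solve 3 (λ x f₂ f₀ → f₂ :- x :* f₀ := con (+ 1) :* f₂ :- x :* f₀) ≈-refl X f₂ f₀)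
      (all-F-odd T T-◁)
  , ≈-trans
      (solve 2 (λ f₂ f₀ → f₂ := con (+ 1) :* f₂ :- con (+ 0) :* f₀) ≈-refl f₂ f₀)
      (all-F-odd U U-◁)
  , ≈-trans
      (solve 3 (λ x f₁ f₋₁ → f₁ :- x :* f₋₁ := con (+ 1) :* f₁ :- x :* f₋₁) ≈-refl X f₁ f₋₁)
      (all-F-even T T-◁)
  , ≈-trans
      (solve 2 (λ f₁ f₋₁ → f₁ := con (+ 1) :* f₁ :- con (+ 0) :* f₋₁) ≈-refl f₁ f₋₁)
      (all-F-even U U-◁)
  where
  open ≈-Reasoning ≈-setoid

  B D : ℤ[x]
  B = C (+ 3) * X ^ 2 - C (+ 4)
  D = X ^ 2 - C (+ 2) * X + C (+ 2)

  f₋₁ = F (2 ℕ.* suc N ∸ 2)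
  f₀  = F (2 ℕ.* suc N ∸ 1)
  f₁  = F (2 ℕ.* suc N)
  f₂  = F (2 ℕ.* suc N ℕ.+ 1)

  -- `j` stands for n - k, which is at least 2 in the sums, so no subtraction is truncated.
  odd even : (ℕ → ℤ[x]) → ℕ → ℤ[x]
  odd  s j = (C (+ 4) * X ^ 2 - X - C (+ 2)) * s (2 ℕ.* j ∸ 1) - C (+ 2) * s (2 ℕ.* j ∸ 3)
  even s j = (C (+ 4) * X ^ 2 - X - C (+ 2)) * s (2 ℕ.* (j ∸ 1)) - C (+ 2) * s (2 ℕ.* (j ∸ 2))

  odd-F : ∀ s → Recurrence (C (+ 2) * X) (- C (+ 1)) s →
    s 1 * F (suc N) + (s 3 - X * s 1) * F N
      ≈ s (2 ℕ.* suc N ∸ 1) - ∑[ k from 1 to (N ∸ 1) ] (odd s (suc N ∸ k) * F k)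
  odd-F s rec = ≈-trans
    (convolution-F (Chebyshev-bisection (shift rec)) N (odd s) λ m → ≈-reflexive (cong₂
      (λ i j → (C (+ 4) * X ^ 2 - X - C (+ 2)) * s i - C (+ 2) * s j)
      (2*[1+n]∸1 (1 ℕ.+ m)) (cong (_∸ 3) (ℕ.*-distribˡ-+ 2 2 m))))
    (≈-reflexive (cong (λ i → s i - ∑[ k from 1 to (N ∸ 1) ] (odd s (suc N ∸ k) * F k))
      (≡.sym (2*[1+n]∸1 N))))

  even-F : ∀ s → Recurrence (C (+ 2) * X) (- C (+ 1)) s →
    s 0 * F (suc N) + (s 2 - X * s 0) * F N
      ≈ s (2 ℕ.* suc N ∸ 2) - ∑[ k from 1 to (N ∸ 1) ] (even s (suc N ∸ k) * F k)
  even-F s rec = ≈-trans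
    -- At `j = 2 ℕ.+ m` both indices of `even` reduce by computation; those of `odd` need
    -- distributivity first.
    (convolution-F (Chebyshev-bisection rec) N (even s) λ _ → ≈-refl)
    (≈-reflexive (cong (λ i → s i - ∑[ k from 1 to (N ∸ 1) ] (even s (suc N ∸ k) * F k))
      (≡.sym (2*[1+n]∸2 N))))

  even-F-odd : ∀ s {p} →
    Recurrence (X ^ 2 + C (+ 2) + B) (- C (+ 1)) (p ◁ λ m → s (2 ℕ.* m)) →
    s 0 * f₂ - p * f₀
      ≈ s (2 ℕ.* suc N) - s (2 ℕ.* suc N ∸ 2)
        - B * ∑[ k from 0 to N ] (s (2 ℕ.* (suc N ∸ k ∸ 1)) * F (2 ℕ.* k ℕ.+ 1))
  even-F-odd s rec = ≈-trans
    (convolution-F-odd B rec N g λ where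
      m k ≡.refl → ≈-reflexive
        (cong (λ j → s (2 ℕ.* (j ∸ 1)) * F (2 ℕ.* k ℕ.+ 1)) (ℕ.m+n∸n≡m (suc m) k)))
    (≈-reflexive (cong (λ i → s (2 ℕ.* suc N) - s i - B * ∑[ k from 0 to N ] (g k))
      (≡.sym (2*[1+n]∸2 N))))
    where
    g : ℕ → ℤ[x]
    g k = s (2 ℕ.* (suc N ∸ k ∸ 1)) * F (2 ℕ.* k ℕ.+ 1)

  odd-F-even : ∀ s {p} →
    Recurrence (X ^ 2 + C (+ 2) + B) (- C (+ 1)) (p ◁ λ m → s (1 ℕ.+ 2 ℕ.* m)) →
    s 1 * f₁ - p * f₋₁
      ≈ X * s (2 ℕ.* suc N ∸ 1)
        - B * ∑[ k from 1 to N ] (s (2 ℕ.* (suc N ∸ k) ∸ 1) * F (2 ℕ.* k))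
  odd-F-even s rec = ≈-trans
    (convolution-F-even B rec N g λ where
      m k ≡.refl → ≈-reflexive (cong (λ j → s j * F (2 ℕ.* suc k))
        (≡.trans (cong (λ j → 2 ℕ.* j ∸ 1) (ℕ.m+n∸n≡m (suc m) k)) (2*[1+n]∸1 m))))
    (≈-reflexive (cong (λ i → X * s i - B * ∑[ k from 1 to N ] (g k)) (≡.sym (2*[1+n]∸1 N))))
    where
    g : ℕ → ℤ[x]
    g k = s (2 ℕ.* (suc N ∸ k) ∸ 1) * F (2 ℕ.* k)

  all-F-odd : ∀ s {p} → Recurrence (X ^ 2 + C (+ 2) + (- D)) (- C (+ 1)) (p ◁ s) →
    s 0 * f₂ - p * f₀
      ≈ s (suc N) - s N + D * ∑[ k from 0 to N ] (s (N ∸ k) * F (2 ℕ.* k ℕ.+ 1))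
  all-F-odd s rec = ≈-trans
    (convolution-F-odd (- D) rec N g λ where
      m k ≡.refl → ≈-reflexive (cong (λ j → s j * F (2 ℕ.* k ℕ.+ 1)) (ℕ.m+n∸n≡m m k)))
    (p-[-q]r≈p+qr (s (suc N) - s N) D (∑[ k from 0 to N ] (g k)))
    where
    g : ℕ → ℤ[x]
    g k = s (N ∸ k) * F (2 ℕ.* k ℕ.+ 1)

  all-F-even : ∀ s {p} → Recurrence (X ^ 2 + C (+ 2) + (- D)) (- C (+ 1)) (p ◁ s) →
    s 0 * f₁ - p * f₋₁ ≈ X * s N + D * ∑[ k from 1 to N ] (s (N ∸ k) * F (2 ℕ.* k))
  all-F-even s rec = ≈-trans
    (convolution-F-even (- D) rec N g λ where
      m k ≡.refl → ≈-reflexive (cong (λ j → s j * F (2 ℕ.* suc k)) (ℕ.m+n∸n≡m m k)))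
    (p-[-q]r≈p+qr (X * s N) D (∑[ k from 1 to N ] (g k)))
    where
    g : ℕ → ℤ[x]
    g k = s (N ∸ k) * F (2 ℕ.* k)
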